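{- Let $F$ be a simple graph of order $n\ge1$ and let $V_k=\{v_1,\ldots,v_k\}\subseteq V(F)$ with $|V_k|=k$. Let $H_u$ and $H_v$ be two disjoint simple graphs of order $m$ with specified vertices $u$ of $H_u$ and $v$ of $H_v$, each of degree $m-1$ in its graph, such that $H_u-u$ and $H_v-v$ are $r_1$-regular, where $m\ge2$ and $r_1\ge1$. If $H_u$ and $H_v$ are $A$-cospectral, then $G[F,V_k,H_u]$ and $G[F,V_k,H_v]$ are $A$-cospectral.
   Context: All graphs are finite and simple. Two graphs are $A$-cospectral if their adjacency matrices have the same spectrum (with multiplicities). Graph with $k$ pockets: for a graph $H_w$ with specified vertex $w$, $G[F,V_k,H_w]$ is obtained by taking one copy of $F$ and $k$ vertex-disjoint copies of $H_w$, and, for each $i=1,\ldots,k$, identifying the vertex $w$ of the $i$th copy of $H_w$ with the vertex $v_i$ of $F$. -}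

module Defs where

open import Level using (Level; _⊔_)
open import Algebra.Apartness.Bundles using (HeytingField; HeytingCommutativeRing)
open import Algebra.Bundles using (CommutativeRing; Semiring)
import Algebra.Definitions.RawSemiring as RawSemiringDefs
open import Data.Bool.Base using (Bool; true; false; _∧_; if_then_else_)
open import Data.Bool.Properties using (∧-zeroʳ)
open import Data.Fin.Base using (Fin; zero; suc; toℕ; punchIn; splitAt; remQuot)
open import Data.Fin.Properties using (_≟_)
open import Data.Fin.Subset using (Subset; ∣_∣)
open import Data.List.Base using (List; foldr; map)
open import Data.Nat.Base as ℕ using (ℕ; zero; suc; pred)
open import Data.Product.Base using (_×_; _,_; ∃-syntax)
open import Data.Sum.Base using (_⊎_; inj₁; inj₂; map₂)
open import Data.Vec.Base using (tabulate)
open import Data.Vec.Functional using (Vector)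
open import Relation.Binary.PropositionalEquality
  using (_≡_; refl; sym; trans; cong₂)
open import Relation.Nullary.Decidable
  using (does; yes; no; dec-true; dec-false)

------------------------------------------------------------------------
-- Finite simple graphs

record Graph (n : ℕ) : Set where
  field
    adj    : Fin n → Fin n → Bool
    symm   : ∀ a b → adj a b ≡ adj b a
    irrefl : ∀ a → adj a a ≡ false

open Graph public

neighbours : ∀ {n} → Graph n → Fin n → Subset n
neighbours G a = tabulate (adj G a)

degree : ∀ {n} → Graph n → Fin n → ℕ
degree G a = ∣ neighbours G a ∣

Regular : ∀ {n} → ℕ → Graph n → Set
Regular r G = ∀ a → degree G a ≡ r

-- In a graph of order m with a chosen vertex w, the other vertices are
-- numbered by Fin (pred m); `others w` is the inclusion.
others : ∀ {m} → Fin m → Fin (pred m) → Fin m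
others {suc m} w = punchIn w

delete : ∀ {m} → Graph m → Fin m → Graph (pred m)
delete H w = record
  { adj    = λ x y → adj H (others w x) (others w y)
  ; symm   = λ x y → symm H (others w x) (others w y)
  ; irrefl = λ x → irrefl H (others w x)
  }

------------------------------------------------------------------------
-- Graphs with pockets

same : ∀ {k} → Fin k → Fin k → Bool
same i j = does (i ≟ j)

same-sym : ∀ {k} (i j : Fin k) → same i j ≡ same j i
same-sym i j with i ≟ j
... | yes i≡j = sym (dec-true (j ≟ i) (sym i≡j))
... | no  i≢j = sym (dec-false (j ≟ i) (λ j≡i → i≢j (sym j≡i)))

-- Since w of the i-th copy of H is identified with v i, the vertices are
-- those of F (inj₁ a), and the vertices x ≠ w of each copy (inj₂ (i , x)).
-- An edge w – x of the i-th copy becomes an edge between v i and (i , x).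
module _ {n k m : ℕ}
         (F : Graph n) (v : Fin k → Fin n) (H : Graph m) (w : Fin m) where

  PocketVertex : Set
  PocketVertex = Fin n ⊎ (Fin k × Fin (pred m))

  pocketAdj : PocketVertex → PocketVertex → Bool
  pocketAdj (inj₁ a)       (inj₁ b)       = adj F a b
  pocketAdj (inj₁ a)       (inj₂ (j , y)) = same a (v j) ∧ adj H w (others w y)
  pocketAdj (inj₂ (i , x)) (inj₁ b)       = same (v i) b ∧ adj H (others w x) w
  pocketAdj (inj₂ (i , x)) (inj₂ (j , y)) = same i j ∧ adj H (others w x) (others w y)

  pocketAdj-sym : ∀ p q → pocketAdj p q ≡ pocketAdj q p
  pocketAdj-sym (inj₁ a) (inj₁ b) = symm F a b
  pocketAdj-sym (inj₁ a) (inj₂ (j , y)) =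
    cong₂ _∧_ (same-sym a (v j)) (symm H w (others w y))
  pocketAdj-sym (inj₂ (i , x)) (inj₁ b) =
    cong₂ _∧_ (same-sym (v i) b) (symm H (others w x) w)
  pocketAdj-sym (inj₂ (i , x)) (inj₂ (j , y)) =
    cong₂ _∧_ (same-sym i j) (symm H (others w x) (others w y))

  pocketAdj-irrefl : ∀ p → pocketAdj p p ≡ false
  pocketAdj-irrefl (inj₁ a) = irrefl F a
  pocketAdj-irrefl (inj₂ (i , x)) =
    trans (cong₂ _∧_ refl (irrefl H (others w x))) (∧-zeroʳ (same i i))

  -- Numbering of the vertices: first F, then the copies one after another.
  pocketVertex : Fin (n ℕ.+ k ℕ.* pred m) → PocketVertex
  pocketVertex p = map₂ (remQuot (pred m)) (splitAt n p)

  pockets : Graph (n ℕ.+ k ℕ.* pred m)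
  pockets = record
    { adj    = λ p q → pocketAdj (pocketVertex p) (pocketVertex q)
    ; symm   = λ p q → pocketAdj-sym (pocketVertex p) (pocketVertex q)
    ; irrefl = λ p → pocketAdj-irrefl (pocketVertex p)
    }

------------------------------------------------------------------------
-- Spectra

-- The library has no complex numbers, so eigenvalues are taken in an
-- arbitrary algebraically closed field of characteristic zero, such as ℂ.
-- The library's fields carry an apartness relation x # y (x - y invertible).
module _ {c ℓ₁ ℓ₂ : Level} (K : HeytingField c ℓ₁ ℓ₂) where

  open HeytingField K hiding (refl; sym; trans; zero)
  private
    commutativeRing : CommutativeRing c ℓ₁
    commutativeRing = HeytingCommutativeRing.commutativeRing heytingCommutativeRing

  open RawSemiringDefs (Semiring.rawSemiring (CommutativeRing.semiring commutativeRing))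
    using (_^_; sum) renaming (_×_ to _·_)

  CharacteristicZero : Set ℓ₂
  CharacteristicZero = ∀ d → (suc d · 1#) # 0#

  -- Every monic polynomial z^d + a_{d-1} z^{d-1} + … + a_0 with d ≥ 1 has a root.
  AlgebraicallyClosed : Set (c ⊔ ℓ₁)
  AlgebraicallyClosed = ∀ d (a : Vector Carrier (suc d)) →
    ∃[ z ] z ^ suc d + sum (λ i → a i * z ^ toℕ i) ≈ 0#

  Matrix : ℕ → Set c
  Matrix n = Vector (Vector Carrier n) n

  -- Laplace expansion along the first row.
  det : ∀ {n} → Matrix n → Carrier
  det {zero}  A = 1#
  det {suc n} A =
    sum (λ j → (- 1#) ^ toℕ j * A zero j * det (λ a b → A (suc a) (punchIn j b)))

  identity : ∀ {n} → Matrix n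
  identity a b = if does (a ≟ b) then 1# else 0#

  adjacencyMatrix : ∀ {n} → Graph n → Matrix n
  adjacencyMatrix G a b = if adj G a b then 1# else 0#

  -- det (x I - A)
  charPoly : ∀ {n} → Matrix n → Carrier → Carrier
  charPoly A x = det (λ a b → x * identity a b - A a b)

  -- Λ lists the eigenvalues of A with their multiplicities as roots of the
  -- characteristic polynomial: det (x I - A) = ∏ (x - λ) over λ in Λ.  In
  -- characteristic zero the field is infinite, so that agreement for all x
  -- is equality of polynomials, and Λ is determined up to order.
  IsSpectrum : ∀ {n} → Matrix n → List Carrier → Set (c ⊔ ℓ₁)
  IsSpectrum A Λ = ∀ x → charPoly A x ≈ foldr _*_ 1# (map (λ z → x - z) Λ)

  Cospectral : ∀ {n₁ n₂} → Graph n₁ → Graph n₂ → Set (c ⊔ ℓ₁)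
  Cospectral G₁ G₂ =
    ∃[ Λ ] IsSpectrum (adjacencyMatrix G₁) Λ × IsSpectrum (adjacencyMatrix G₂) Λ

{-# OPTIONS --safe #-}

-- Let M = x I - A (H - w), of size p = m - 1.  As H - w is r-regular, the columns
-- of M add up to x - r, and w is adjacent to all other vertices.  Where x - r is
-- invertible, adding the rows of M divided by x - r to the row of w clears that
-- row outside the column of w:  det (x I - A H) = (x - p / (x - r)) det M.  The
-- same operation in each pocket makes x I - A (G [F, V, H]) block triangular, so
-- its determinant is (det M)^k times a factor independent of H.  Hence
-- cospectral H give equal characteristic polynomials at every natural number
-- x > r + p, where all divisors are invertible in characteristic zero, and a
-- polynomial that vanishes at all large naturals vanishes identically.  The list of
-- eigenvalues comes from splitting the common characteristic polynomial.

module Submission where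

open import Defs
open import Level using (Level; _⊔_)
open import Algebra.Apartness.Bundles using (HeytingField; HeytingCommutativeRing)
open import Algebra.Bundles using (CommutativeRing; Semiring)
import Algebra.Definitions.RawSemiring as RawSemiringDefinitions
import Algebra.Properties.Ring as RingProperties
import Algebra.Properties.Semiring.Exp as SemiringExp
import Algebra.Properties.Semiring.Mult as SemiringMult
import Algebra.Properties.Semiring.Sum as SemiringSum
import Algebra.Solver.Ring.NaturalCoefficients.Default as SemiringSolver
open import Data.Bool.Base using (Bool; true; false; _∧_; if_then_else_)
open import Data.Bool.Properties using (∧-identityʳ)
open import Data.Fin.Base
  using (Fin; zero; suc; toℕ; punchIn; pinch; splitAt; remQuot; quotient; combine; _↑ˡ_; _↑ʳ_)
open import Data.Fin.Properties
  using (_≟_; toℕ-↑ˡ; splitAt-↑ˡ; splitAt-↑ʳ; join-splitAt; remQuot-combine; combine-remQuot; punchInᵢ≢i)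
open import Data.Fin.Subset using (∣_∣; ⊤)
open import Data.Fin.Subset.Properties using (∣p∣≡n⇒p≡⊤)
open import Data.List.Base using ([]; _∷_; foldr; map)
open import Data.Nat.Base as ℕ using (ℕ; zero; suc; _≤_; _∸_)
open import Data.Nat.Properties using (+-suc) renaming (+-identityʳ to +-identityʳ-ℕ; +-assoc to +-assoc-ℕ)
open import Data.Nat.Solver using (module +-*-Solver)
open import Data.Product.Base using (_×_; _,_; ∃-syntax; proj₁; proj₂)
open import Data.Sum.Base using (inj₁; inj₂)
open import Data.Vec.Base using (tabulate; lookup)
open import Data.Vec.Properties using (lookup∘tabulate; lookup-replicate)
open import Data.Vec.Functional using (Vector; _++_) renaming (_∷_ to infixr 5 _◂_)
open import Function.Base using (_∘_)
open import Function.Definitions using (Injective)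
open import Relation.Binary.PropositionalEquality as ≡ using (_≡_)
open import Relation.Nullary.Decidable using (dec-true; dec-false)

-- Index arithmetic for deleted columns and for blocks.

punchIn-punchIn-pinch : ∀ {n} (j : Fin (suc n)) (k : Fin n) →
  punchIn (punchIn j k) (pinch k j) ≡ j
punchIn-punchIn-pinch {suc n} zero    k       = ≡.refl
punchIn-punchIn-pinch {suc n} (suc j) zero    = ≡.refl
punchIn-punchIn-pinch {suc n} (suc j) (suc k) = ≡.cong suc (punchIn-punchIn-pinch j k)

-- The columns `j` and `punchIn j k` may be deleted in either order: `pinch k j` is the position of
-- `j` once `punchIn j k` is gone.
punchIn-punchIn-comm : ∀ {n} (j : Fin (suc (suc n))) (k : Fin (suc n)) (b : Fin n) →
  punchIn (punchIn j k) (punchIn (pinch k j) b) ≡ punchIn j (punchIn k b)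
punchIn-punchIn-comm zero    k       b       = ≡.refl
punchIn-punchIn-comm (suc j) zero    b       = ≡.refl
punchIn-punchIn-comm (suc j) (suc k) zero    = ≡.refl
punchIn-punchIn-comm (suc j) (suc k) (suc b) = ≡.cong suc (punchIn-punchIn-comm j k b)

punchIn-↑ˡ : ∀ {n} q (j : Fin (suc n)) (b : Fin n) →
  punchIn (j ↑ˡ q) (b ↑ˡ q) ≡ punchIn j b ↑ˡ q
punchIn-↑ˡ q zero    b       = ≡.refl
punchIn-↑ˡ q (suc j) zero    = ≡.refl
punchIn-↑ˡ q (suc j) (suc b) = ≡.cong suc (punchIn-↑ˡ q j b)

-- Deleting a column of the left block moves the right block one place to the left, hence the
-- offsets `n` and `suc n`.
punchIn-↑ʳ : ∀ n {q} (j : Fin (suc n)) (y : Fin q) →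
  punchIn (j ↑ˡ q) (n ↑ʳ y) ≡ suc n ↑ʳ y
punchIn-↑ʳ n       zero    y = ≡.refl
punchIn-↑ʳ (suc n) (suc j) y = ≡.cong suc (punchIn-↑ʳ n j y)

same-punchIn : ∀ {n} (i : Fin (suc n)) (a b : Fin n) → same (punchIn i a) (punchIn i b) ≡ same a b
same-punchIn zero    a       b       = ≡.refl
same-punchIn (suc i) zero    zero    = ≡.refl
same-punchIn (suc i) zero    (suc b) = ≡.refl
same-punchIn (suc i) (suc a) zero    = ≡.refl
same-punchIn (suc i) (suc a) (suc b) = same-punchIn i a b

same-↑ˡ-↑ˡ : ∀ {n} q (a b : Fin n) → same (a ↑ˡ q) (b ↑ˡ q) ≡ same a b
same-↑ˡ-↑ˡ q zero    zero    = ≡.refl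
same-↑ˡ-↑ˡ q zero    (suc b) = ≡.refl
same-↑ˡ-↑ˡ q (suc a) zero    = ≡.refl
same-↑ˡ-↑ˡ q (suc a) (suc b) = same-↑ˡ-↑ˡ q a b

same-↑ʳ-↑ʳ : ∀ n {q} (x y : Fin q) → same (n ↑ʳ x) (n ↑ʳ y) ≡ same x y
same-↑ʳ-↑ʳ zero    x y = ≡.refl
same-↑ʳ-↑ʳ (suc n) x y = same-↑ʳ-↑ʳ n x y

same-↑ˡ-↑ʳ : ∀ {n q} (a : Fin n) (y : Fin q) → same (a ↑ˡ q) (n ↑ʳ y) ≡ false
same-↑ˡ-↑ʳ zero    y = ≡.refl
same-↑ˡ-↑ʳ (suc a) y = same-↑ˡ-↑ʳ a y

same-↑ʳ-↑ˡ : ∀ {n q} (y : Fin q) (a : Fin n) → same (n ↑ʳ y) (a ↑ˡ q) ≡ false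
same-↑ʳ-↑ˡ {n} {q} y a = ≡.trans (same-sym (n ↑ʳ y) (a ↑ˡ q)) (same-↑ˡ-↑ʳ a y)

same-combine : ∀ {k p} (i : Fin k) (x : Fin p) (j : Fin k) (y : Fin p) →
  same (combine i x) (combine j y) ≡ same i j ∧ same x y
same-combine {suc k} {p} zero    x zero    y = same-↑ˡ-↑ˡ (k ℕ.* p) x y
same-combine {suc k} {p} zero    x (suc j) y = same-↑ˡ-↑ʳ x (combine j y)
same-combine {suc k} {p} (suc i) x zero    y = same-↑ʳ-↑ˡ (combine i x) y
same-combine {suc k} {p} (suc i) x (suc j) y =
  ≡.trans (same-↑ʳ-↑ʳ p (combine i x) (combine j y)) (same-combine i x j y)

module LinearAlgebra {c ℓ₁ ℓ₂ : Level} (K : HeytingField c ℓ₁ ℓ₂) where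

  K-ring : CommutativeRing c ℓ₁
  K-ring = HeytingCommutativeRing.commutativeRing (HeytingField.heytingCommutativeRing K)

  open CommutativeRing K-ring hiding (zero)
  open RingProperties ring
  open RawSemiringDefinitions (Semiring.rawSemiring semiring) using (_^_) renaming (_×_ to _·_)
  open SemiringSum semiring
  open SemiringExp semiring using (^-congˡ)
  open SemiringMult semiring using (×-homo-+; ×1-homo-*)
  open SemiringSolver commutativeSemiring using (solve; _:=_; _:+_; _:*_; con)
  open import Relation.Binary.Reasoning.Setoid setoid

  -- Finite sums.

  sum-cong : ∀ {n} {f g : Vector Carrier n} → (∀ i → f i ≈ g i) → sum f ≈ sum g
  sum-cong = sum-cong-≋

  sum-zero : ∀ {n} {f : Vector Carrier n} → (∀ i → f i ≈ 0#) → sum f ≈ 0#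
  sum-zero {n} f≈0 = trans (sum-cong f≈0) (sum-replicate-zero n)

  sum-neg : ∀ {n} (f : Vector Carrier n) → sum (λ i → - f i) ≈ - sum f
  sum-neg f = begin
    sum (λ i → - f i)       ≈⟨ sum-cong (λ i → -1*x≈-x (f i)) ⟨
    sum (λ i → - 1# * f i)  ≈⟨ *-distribˡ-sum (- 1#) f ⟨
    - 1# * sum f            ≈⟨ -1*x≈-x (sum f) ⟩
    - sum f                 ∎

  sum-↑ : ∀ m {n} (f : Vector Carrier (m ℕ.+ n)) →
    sum f ≈ sum (λ i → f (i ↑ˡ n)) + sum (λ j → f (m ↑ʳ j))
  sum-↑ zero    f = sym (+-identityˡ _)
  sum-↑ (suc m) f = trans (+-congˡ (sum-↑ m (f ∘ suc))) (sym (+-assoc _ _ _))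

  sum-combine : ∀ k {p} (f : Vector Carrier (k ℕ.* p)) →
    sum f ≈ sum (λ i → sum (λ x → f (combine {k} i x)))
  sum-combine zero        f = refl
  sum-combine (suc k) {p} f = trans (sum-↑ p f) (+-congˡ (sum-combine k (λ q → f (p ↑ʳ q))))

  sum-single : ∀ {n} (i : Fin (suc n)) (f : Vector Carrier (suc n)) →
    (∀ j → f (punchIn i j) ≈ 0#) → sum f ≈ f i
  sum-single i f f≈0 =
    trans (sum-remove f) (trans (+-congˡ (sum-zero f≈0)) (+-identityʳ (f i)))

  sum-same : ∀ {n} (j : Fin n) (f : Vector Carrier n) →
    sum (λ i → if same i j then f i else 0#) ≈ f j
  sum-same {suc n} zero f =
    trans (+-congˡ (sum-replicate-zero n)) (+-identityʳ (f zero))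
  sum-same (suc j) f = trans (+-identityˡ _) (sum-same j (f ∘ suc))

  -- (j , k) ↦ (punchIn j k , pinch k j) exchanges the two elements j and
  -- punchIn j k of the pair that (j , k) encodes.
  sum-antisymmetric : ∀ {n} (f : Fin (suc n) → Fin n → Carrier) →
    (∀ j k → f (punchIn j k) (pinch k j) ≈ - f j k) →
    sum (λ j → sum (f j)) ≈ 0#
  sum-antisymmetric {zero}  f anti = +-identityʳ 0#
  sum-antisymmetric {suc n} f anti = begin
    sum (f zero) + sum (λ j → f (suc j) zero + sum (f (suc j) ∘ suc))
      ≈⟨ +-congˡ (∑-distrib-+ (λ j → f (suc j) zero) (λ j → sum (f (suc j) ∘ suc))) ⟩
    sum (f zero) + (sum (λ j → f (suc j) zero) + sum (λ j → sum (f (suc j) ∘ suc)))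
      ≈⟨ +-congˡ (+-cong
           (trans (sum-cong (anti zero)) (sum-neg (f zero)))
           (sum-antisymmetric (λ j k → f (suc j) (suc k)) (λ j k → anti (suc j) (suc k)))) ⟩
    sum (f zero) + (- sum (f zero) + 0#)
      ≈⟨ +-congˡ (+-identityʳ _) ⟩
    sum (f zero) - sum (f zero)
      ≈⟨ -‿inverseʳ _ ⟩
    0# ∎

  -- Determinants

  Mat : ℕ → Set c
  Mat n = Matrix K n

  Row : ℕ → Set c
  Row = Vector Carrier

  ε : ∀ {n} → Fin n → Carrier
  ε j = (- 1#) ^ toℕ j

  minor : ∀ {n} → Mat (suc n) → Fin (suc n) → Mat n
  minor A j a b = A (suc a) (punchIn j b)

  ε-suc² : ∀ x y → (- 1# * x) * (- 1# * y) ≈ x * y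
  ε-suc² x y = begin
    (- 1# * x) * (- 1# * y)  ≈⟨ *-cong (-1*x≈-x x) (-1*x≈-x y) ⟩
    - x * - y                ≈⟨ -‿distribˡ-* x (- y) ⟨
    - (x * - y)              ≈⟨ -‿cong (-‿distribʳ-* x y) ⟨
    - - (x * y)              ≈⟨ -‿involutive (x * y) ⟩
    x * y                    ∎

  ε*ε≈1 : ∀ {n} (j : Fin n) → ε j * ε j ≈ 1#
  ε*ε≈1 zero    = *-identityˡ 1#
  ε*ε≈1 (suc j) = trans (ε-suc² (ε j) (ε j)) (ε*ε≈1 j)

  -- Of two deleted columns, the one deleted second drops by one in position only if it is the
  -- larger. The two orders of deletion therefore give exponents whose sums differ by one.
  ε-exchange : ∀ {n} (j : Fin (suc n)) (k : Fin n) →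
    ε (punchIn j k) * ε (pinch k j) ≈ - (ε j * ε k)
  ε-exchange {suc n} zero k = begin
    (- 1# * ε k) * 1#  ≈⟨ *-identityʳ _ ⟩
    - 1# * ε k         ≈⟨ -1*x≈-x (ε k) ⟩
    - ε k              ≈⟨ -‿cong (*-identityˡ (ε k)) ⟨
    - (1# * ε k)       ∎
  ε-exchange {suc n} (suc j) zero = begin
    1# * ε j              ≈⟨ *-identityˡ (ε j) ⟩
    ε j                   ≈⟨ -‿involutive (ε j) ⟨
    - - ε j               ≈⟨ -‿cong (-1*x≈-x (ε j)) ⟨
    - (- 1# * ε j)        ≈⟨ -‿cong (*-identityʳ _) ⟨
    - (- 1# * ε j * 1#)   ∎
  ε-exchange {suc n} (suc j) (suc k) = begin
    (- 1# * ε (punchIn j k)) * (- 1# * ε (pinch k j))  ≈⟨ ε-suc² _ _ ⟩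
    ε (punchIn j k) * ε (pinch k j)                    ≈⟨ ε-exchange j k ⟩
    - (ε j * ε k)                                      ≈⟨ -‿cong (ε-suc² (ε j) (ε k)) ⟨
    - ((- 1# * ε j) * (- 1# * ε k))                    ∎

  det-cong : ∀ {n} {A B : Mat n} → (∀ a b → A a b ≈ B a b) → det K A ≈ det K B
  det-cong {zero}  A≈B = refl
  det-cong {suc n} A≈B = sum-cong λ j →
    *-cong (*-congˡ {ε j} (A≈B zero j)) (det-cong λ a b → A≈B (suc a) (punchIn j b))

  det-cong-rows : ∀ {n} {r s : Row (suc n)} {B D : Vector (Row (suc n)) n} →
    (∀ j → r j ≈ s j) → (∀ a b → B a b ≈ D a b) → det K (r ◂ B) ≈ det K (s ◂ D)
  det-cong-rows r≈s B≈D = sum-cong λ j →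
    *-cong (*-congˡ {ε j} (r≈s j)) (det-cong λ a b → B≈D a (punchIn j b))

  -- Alternation of the determinant and operations on the first row.

  expand₂ : ∀ {n} (r s : Row (2 ℕ.+ n)) (B : Vector (Row (2 ℕ.+ n)) n) →
    Fin (2 ℕ.+ n) → Fin (suc n) → Carrier
  expand₂ r s B j k =
    ε j * r j * (ε k * s (punchIn j k) * det K (λ a b → B a (punchIn j (punchIn k b))))

  det-expand₂ : ∀ {n} (r s : Row (2 ℕ.+ n)) (B : Vector (Row (2 ℕ.+ n)) n) →
    det K (r ◂ s ◂ B) ≈ sum (λ j → sum (expand₂ r s B j))
  det-expand₂ r s B = sum-cong λ j →
    *-distribˡ-sum (ε j * r j) (λ k →
      ε k * s (punchIn j k) * det K (λ a b → B a (punchIn j (punchIn k b))))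

  -- After the exchange the two rows have traded columns and the remaining minor omits the same two
  -- columns, so only the sign of `ε-exchange` is left.
  expand₂-exchange : ∀ {n} (r s : Row (2 ℕ.+ n)) (B : Vector (Row (2 ℕ.+ n)) n) j k →
    expand₂ r s B (punchIn j k) (pinch k j) ≈ - expand₂ s r B j k
  expand₂-exchange r s B j k = begin
    expand₂ r s B j′ k′
      ≈⟨ *-congˡ (*-cong (*-congˡ (reflexive (≡.cong s (punchIn-punchIn-pinch j k))))
           (det-cong λ a b → reflexive (≡.cong (B a) (punchIn-punchIn-comm j k b)))) ⟩
    ε j′ * r j′ * (ε k′ * s j * D)
      ≈⟨ solve 5 (λ e r f s d → (e :* r) :* ((f :* s) :* d) := (e :* f) :* ((s :* r) :* d))
           refl (ε j′) (r j′) (ε k′) (s j) D ⟩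
    ε j′ * ε k′ * (s j * r j′ * D)
      ≈⟨ *-congʳ (ε-exchange j k) ⟩
    - (ε j * ε k) * (s j * r j′ * D)
      ≈⟨ -‿distribˡ-* _ _ ⟨
    - (ε j * ε k * (s j * r j′ * D))
      ≈⟨ -‿cong (solve 5 (λ e r f s d → (e :* f) :* ((s :* r) :* d) := (e :* s) :* ((f :* r) :* d))
           refl (ε j) (r j′) (ε k) (s j) D) ⟩
    - expand₂ s r B j k ∎
    where
    j′ = punchIn j k
    k′ = pinch k j
    D = det K (λ a b → B a (punchIn j (punchIn k b)))

  -- With equal rows the exchange negates each term of the double expansion, so the terms cancel in
  -- pairs and no division by 2 enters.
  det-equal₀₁ : ∀ {n} (r : Row (2 ℕ.+ n)) (B : Vector (Row (2 ℕ.+ n)) n) →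
    det K (r ◂ r ◂ B) ≈ 0#
  det-equal₀₁ r B =
    trans (det-expand₂ r r B) (sum-antisymmetric (expand₂ r r B) (expand₂-exchange r r B))

  -- The exchange sends each term of one expansion to the negative of a term of the other, so their
  -- termwise sum is antisymmetric.
  det-swap₀₁ : ∀ {n} (r s : Row (2 ℕ.+ n)) (B : Vector (Row (2 ℕ.+ n)) n) →
    det K (r ◂ s ◂ B) ≈ - det K (s ◂ r ◂ B)
  det-swap₀₁ r s B = +-inverseˡ-unique _ _ (begin
    det K (r ◂ s ◂ B) + det K (s ◂ r ◂ B)
      ≈⟨ +-cong (det-expand₂ r s B) (det-expand₂ s r B) ⟩
    sum (λ j → sum (rs j)) + sum (λ j → sum (sr j))
      ≈⟨ ∑-distrib-+ (λ j → sum (rs j)) (λ j → sum (sr j)) ⟨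
    sum (λ j → sum (rs j) + sum (sr j))
      ≈⟨ sum-cong (λ j → ∑-distrib-+ (rs j) (sr j)) ⟨
    sum (λ j → sum (λ k → rs j k + sr j k))
      ≈⟨ sum-antisymmetric (λ j k → rs j k + sr j k) (λ j k →
           trans (+-cong (expand₂-exchange r s B j k) (expand₂-exchange s r B j k))
             (trans (-‿+-comm _ _) (-‿cong (+-comm _ _)))) ⟩
    0# ∎)
    where
    rs = expand₂ r s B
    sr = expand₂ s r B

  mutual
    -- `ε w` is the sign of the cycle that lifts row `w` over the rows before it. `det-moveRow₁`
    -- lifts it to second place inside the minors along row 0, which are one size smaller; swapping
    -- the top two rows gives the last sign.
    det-moveRow : ∀ {n} (A : Mat (suc n)) (w : Fin (suc n)) →
      det K A ≈ ε w * det K (A w ◂ A ∘ punchIn w)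
    det-moveRow A zero = sym (*-identityˡ _)
    det-moveRow {suc n} A (suc w) = begin
      det K A
        ≈⟨ det-moveRow₁ A w ⟩
      ε w * det K (A zero ◂ A (suc w) ◂ rest)
        ≈⟨ *-congˡ (det-swap₀₁ (A zero) (A (suc w)) rest) ⟩
      ε w * - det K (A (suc w) ◂ A zero ◂ rest)
        ≈⟨ -‿distribʳ-* _ _ ⟨
      - (ε w * det K (A (suc w) ◂ A zero ◂ rest))
        ≈⟨ -1*x≈-x _ ⟨
      - 1# * (ε w * det K (A (suc w) ◂ A zero ◂ rest))
        ≈⟨ *-assoc _ _ _ ⟨
      ε (suc w) * det K (A (suc w) ◂ A zero ◂ rest)
        ≈⟨ *-congˡ (det-cong {A = A (suc w) ◂ A zero ◂ rest} {B = A (suc w) ◂ A ∘ punchIn (suc w)}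
             λ { zero b → refl ; (suc zero) b → refl ; (suc (suc a)) b → refl }) ⟩
      ε (suc w) * det K (A (suc w) ◂ A ∘ punchIn (suc w)) ∎
      where
      rest : Vector (Row (2 ℕ.+ n)) n
      rest a = A (suc (punchIn w a))

    det-moveRow₁ : ∀ {n} (A : Mat (2 ℕ.+ n)) (w : Fin (suc n)) →
      det K A ≈ ε w * det K (A zero ◂ A (suc w) ◂ λ a → A (suc (punchIn w a)))
    det-moveRow₁ A w = begin
      sum (λ j → ε j * A zero j * det K (minor A j))
        ≈⟨ sum-cong (λ j → trans
             (*-congˡ (trans (det-moveRow (minor A j) w)
               (*-congˡ (det-cong {A = minor A j w ◂ minor A j ∘ punchIn w} {B = minor A′ j}
                 λ { zero b → refl ; (suc a) b → refl }))))
             (solve 3 (λ x y z → x :* (y :* z) := y :* (x :* z)) refl (ε j * A zero j) (ε w) (det K (minor A′ j)))) ⟩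
      sum (λ j → ε w * (ε j * A zero j * det K (minor A′ j)))
        ≈⟨ *-distribˡ-sum (ε w) (λ j → ε j * A zero j * det K (minor A′ j)) ⟨
      ε w * det K A′ ∎
      where
      A′ = A zero ◂ A (suc w) ◂ λ a → A (suc (punchIn w a))

  det-equal₀ : ∀ {n} (A : Mat (suc n)) (w : Fin n) →
    (∀ j → A zero j ≈ A (suc w) j) → det K A ≈ 0#
  det-equal₀ {suc n} A w A₀≈Aw = begin
    det K A                                    ≈⟨ det-moveRow₁ A w ⟩
    ε w * det K (A zero ◂ A (suc w) ◂ rest)    ≈⟨ *-congˡ (det-cong-rows {B = A (suc w) ◂ rest} A₀≈Aw λ _ _ → refl) ⟩
    ε w * det K (A (suc w) ◂ A (suc w) ◂ rest) ≈⟨ *-congˡ (det-equal₀₁ (A (suc w)) rest) ⟩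
    ε w * 0#                                   ≈⟨ zeroʳ _ ⟩
    0# ∎
    where
    rest : Vector (Row (2 ℕ.+ n)) n
    rest a = A (suc (punchIn w a))

  -- By linearity in row 0, each added multiple contributes a determinant whose row 0 recurs further
  -- down.
  det-addRows₀ : ∀ {n q} (r : Row (suc n)) (B : Vector (Row (suc n)) n)
    (t : Fin q → Carrier) (g : Fin q → Fin n) →
    det K ((λ j → r j + sum (λ y → t y * B (g y) j)) ◂ B) ≈ det K (r ◂ B)
  det-addRows₀ r B t g = begin
    sum (λ j → ε j * (r j + sum (λ y → t y * B (g y) j)) * D j)
      ≈⟨ sum-cong (λ j → solve 4 (λ e r s d → (e :* (r :+ s)) :* d := (e :* r) :* d :+ (e :* d) :* s)
           refl (ε j) (r j) (sum (λ y → t y * B (g y) j)) (D j)) ⟩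
    sum (λ j → ε j * r j * D j + ε j * D j * sum (λ y → t y * B (g y) j))
      ≈⟨ ∑-distrib-+ (λ j → ε j * r j * D j) (λ j → ε j * D j * sum (λ y → t y * B (g y) j)) ⟩
    det K (r ◂ B) + sum (λ j → ε j * D j * sum (λ y → t y * B (g y) j))
      ≈⟨ +-congˡ (sum-cong λ j → trans (*-distribˡ-sum (ε j * D j) (λ y → t y * B (g y) j))
           (sum-cong λ y → solve 4 (λ e d t b → (e :* d) :* (t :* b) := t :* ((e :* b) :* d))
              refl (ε j) (D j) (t y) (B (g y) j))) ⟩
    det K (r ◂ B) + sum (λ j → sum (λ y → t y * (ε j * B (g y) j * D j)))
      ≈⟨ +-congˡ (∑-comm (λ j y → t y * (ε j * B (g y) j * D j))) ⟩
    det K (r ◂ B) + sum (λ y → sum (λ j → t y * (ε j * B (g y) j * D j)))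
      ≈⟨ +-congˡ (sum-zero λ y → begin
           sum (λ j → t y * (ε j * B (g y) j * D j))
             ≈⟨ *-distribˡ-sum (t y) (λ j → ε j * B (g y) j * D j) ⟨
           t y * det K (B (g y) ◂ B)
             ≈⟨ *-congˡ (det-equal₀ (B (g y) ◂ B) (g y) λ _ → refl) ⟩
           t y * 0#
             ≈⟨ zeroʳ (t y) ⟩
           0# ∎) ⟩
    det K (r ◂ B) + 0#
      ≈⟨ +-identityʳ _ ⟩
    det K (r ◂ B) ∎
    where
    D = λ j → det K (λ a b → B a (punchIn j b))

  -- Determinants of block matrices.

  ++-suc : ∀ {a} {X : Set a} {n q} (T : Vector X (suc n)) (B : Vector X q) i →
    (T ++ B) (suc i) ≡ ((T ∘ suc) ++ B) i
  ++-suc {n = n} T B i with splitAt n i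
  ... | inj₁ _ = ≡.refl
  ... | inj₂ _ = ≡.refl

  ++-↑ʳ : ∀ {a} {X : Set a} {n q} (T : Vector X n) (B : Vector X q) y → (T ++ B) (n ↑ʳ y) ≡ B y
  ++-↑ʳ {n = n} {q} T B y rewrite splitAt-↑ʳ n q y = ≡.refl

  ++-↑ˡ : ∀ {a} {X : Set a} {n q} (T : Vector X n) (B : Vector X q) i → (T ++ B) (i ↑ˡ q) ≡ T i
  ++-↑ˡ {n = n} {q} T B i rewrite splitAt-↑ˡ n i q = ≡.refl

  minor-++ : ∀ {n q} (T : Vector (Row (suc n ℕ.+ q)) (suc n)) (B : Vector (Row (suc n ℕ.+ q)) q) j a b →
    minor (T ++ B) j a b ≡
      ((λ i b → T (suc i) (punchIn j b)) ++ (λ y b → B y (punchIn j b))) a b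
  minor-++ {n} T B j a b with splitAt n a
  ... | inj₁ _ = ≡.refl
  ... | inj₂ _ = ≡.refl

  -- The added combinations involve only rows of `B`, which stay fixed, so the upper rows can be
  -- treated one at a time.
  det-addRows : ∀ {n q} (T : Vector (Row (n ℕ.+ q)) n) (B : Vector (Row (n ℕ.+ q)) q)
    (C : Fin n → Fin q → Carrier) →
    det K ((λ a j → T a j + sum (λ y → C a y * B y j)) ++ B) ≈ det K (T ++ B)
  det-addRows {zero}      T B C = refl
  det-addRows {suc n} {q} T B C = begin
    det K (T′ ++ B)
      -- The upper rows other than row 0 are restored first, inside the minors along row 0; row 0
      -- itself is left to `det-addRows₀`.
      ≈⟨ sum-cong (λ j → *-congˡ {ε j * T′ zero j} (begin
           det K (minor (T′ ++ B) j)
             ≈⟨ det-cong (λ a b → reflexive (minor-++ T′ B j a b)) ⟩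
           det K ((λ i b → T′ (suc i) (punchIn j b)) ++ (λ y b → B y (punchIn j b)))
             ≈⟨ det-addRows (λ i b → T (suc i) (punchIn j b)) (λ y b → B y (punchIn j b)) (C ∘ suc) ⟩
           det K ((λ i b → T (suc i) (punchIn j b)) ++ (λ y b → B y (punchIn j b)))
             ≈⟨ det-cong (λ a b → reflexive (minor-++ T B j a b)) ⟨
           det K (minor (T ++ B) j) ∎)) ⟩
    det K (T′ zero ◂ rest)
      ≈⟨ det-cong-rows {B = rest} (λ j → +-congˡ {T zero j} (sum-cong λ y →
           *-congˡ {C zero y} (reflexive (≡.sym (≡.cong (λ row → row j)
             (≡.trans (++-suc T B (n ↑ʳ y)) (++-↑ʳ (T ∘ suc) B y)))))))
           (λ _ _ → refl) ⟩
    det K ((λ j → T zero j + sum (λ y → C zero y * rest (n ↑ʳ y) j)) ◂ rest)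
      ≈⟨ det-addRows₀ (T zero) rest (C zero) (n ↑ʳ_) ⟩
    det K (T ++ B) ∎
    where
    T′ = λ a j → T a j + sum (λ y → C a y * B y j)
    rest = (T ++ B) ∘ suc

  -- In the expansion along row 0 the columns of the right block contribute zero, and every other
  -- minor is again block triangular with the same lower right block.
  det-blockTriangular : ∀ n {q} (M : Mat (n ℕ.+ q)) →
    (∀ a y → M (a ↑ˡ q) (n ↑ʳ y) ≈ 0#) →
    det K M ≈ det K (λ a b → M (a ↑ˡ q) (b ↑ˡ q)) * det K (λ x y → M (n ↑ʳ x) (n ↑ʳ y))
  det-blockTriangular zero    M M₁₂≈0 = sym (*-identityˡ _)
  det-blockTriangular (suc n) {q} M M₁₂≈0 = begin
    sum term
      ≈⟨ sum-↑ (suc n) term ⟩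
    sum (λ j → term (j ↑ˡ q)) + sum (λ y → term (suc n ↑ʳ y))
      ≈⟨ +-cong (sum-cong left) (sum-zero right) ⟩
    sum (λ j → ε j * P zero j * det K (minor P j) * det K S) + 0#
      ≈⟨ +-identityʳ _ ⟩
    sum (λ j → ε j * P zero j * det K (minor P j) * det K S)
      ≈⟨ *-distribʳ-sum (det K S) (λ j → ε j * P zero j * det K (minor P j)) ⟨
    det K P * det K S ∎
    where
    P : Mat (suc n)
    P a b = M (a ↑ˡ q) (b ↑ˡ q)
    S : Mat q
    S x y = M (suc n ↑ʳ x) (suc n ↑ʳ y)
    term : Fin (suc n ℕ.+ q) → Carrier
    term j = ε j * M zero j * det K (minor M j)

    right : ∀ y → term (suc n ↑ʳ y) ≈ 0#
    right y = trans (*-congʳ (trans (*-congˡ (M₁₂≈0 zero y)) (zeroʳ _))) (zeroˡ _)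

    left : ∀ j → term (j ↑ˡ q) ≈ ε j * P zero j * det K (minor P j) * det K S
    left j = begin
      ε (j ↑ˡ q) * P zero j * det K (minor M (j ↑ˡ q))
        ≈⟨ *-cong (*-congʳ (reflexive (≡.cong ((- 1#) ^_) (toℕ-↑ˡ j q))))
             (trans (det-blockTriangular n (minor M (j ↑ˡ q)) (λ a y →
                trans (reflexive (≡.cong (M (suc a ↑ˡ q)) (punchIn-↑ʳ n j y))) (M₁₂≈0 (suc a) y)))
               (*-cong
                 (det-cong {n} λ a b → reflexive (≡.cong (M (suc a ↑ˡ q)) (punchIn-↑ˡ q j b)))
                 (det-cong {q} λ x y → reflexive (≡.cong (M (suc n ↑ʳ x)) (punchIn-↑ʳ n j y))))) ⟩
      ε j * P zero j * (det K (minor P j) * det K S)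
        ≈⟨ *-assoc _ _ _ ⟨
      ε j * P zero j * det K (minor P j) * det K S ∎

  -- `C` stands for minus the upper right block times the inverse of the lower right one. Taking it
  -- as data, with the equation it has to satisfy, avoids inverting a matrix.
  det-schur : ∀ n {q} (M : Mat (n ℕ.+ q)) (C : Fin n → Fin q → Carrier) →
    (∀ a y → M (a ↑ˡ q) (n ↑ʳ y) + sum (λ z → C a z * M (n ↑ʳ z) (n ↑ʳ y)) ≈ 0#) →
    det K M ≈
      det K (λ a b → M (a ↑ˡ q) (b ↑ˡ q) + sum (λ z → C a z * M (n ↑ʳ z) (b ↑ˡ q))) *
      det K (λ x y → M (n ↑ʳ x) (n ↑ʳ y))
  det-schur n {q} M C M₁₂′≈0 = begin
    det K M
      ≈⟨ det-cong {n ℕ.+ q} (λ a b → reflexive (≡.cong (λ row → row b) (rows a))) ⟩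
    det K (T ++ B)
      ≈⟨ det-addRows T B C ⟨
    det K (T′ ++ B)
      ≈⟨ det-blockTriangular n (T′ ++ B) (λ a y →
           trans (reflexive (≡.cong (λ row → row (n ↑ʳ y)) (++-↑ˡ T′ B a))) (M₁₂′≈0 a y)) ⟩
    det K (λ a b → (T′ ++ B) (a ↑ˡ q) (b ↑ˡ q)) * det K (λ x y → (T′ ++ B) (n ↑ʳ x) (n ↑ʳ y))
      ≈⟨ *-cong
           (det-cong {n} λ a b → reflexive (≡.cong (λ row → row (b ↑ˡ q)) (++-↑ˡ T′ B a)))
           (det-cong {q} λ x y → reflexive (≡.cong (λ row → row (n ↑ʳ y)) (++-↑ʳ T′ B x))) ⟩
    det K (λ a b → T′ a (b ↑ˡ q)) * det K (λ x y → B x (n ↑ʳ y)) ∎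
    where
    T : Vector (Row (n ℕ.+ q)) n
    T a = M (a ↑ˡ q)
    B : Vector (Row (n ℕ.+ q)) q
    B y = M (n ↑ʳ y)
    T′ : Vector (Row (n ℕ.+ q)) n
    T′ a j = T a j + sum (λ y → C a y * B y j)
    rows : ∀ a → M a ≡ (T ++ B) a
    -- `join-splitAt` is abstracted together with `splitAt n a`, so that in each branch it
    -- identifies `a` itself.
    rows a with splitAt n a | ≡.sym (join-splitAt n q a)
    ... | inj₁ _ | eq = ≡.cong M eq
    ... | inj₂ _ | eq = ≡.cong M eq

  det-blockDiagonal : ∀ k {p} (M : Mat p) (N : Mat (k ℕ.* p)) →
    (∀ i x j y → N (combine {k} i x) (combine {k} j y) ≈ (if same i j then M x y else 0#)) →
    det K N ≈ det K M ^ k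
  det-blockDiagonal zero        M N blocks = refl
  det-blockDiagonal (suc k) {p} M N blocks = begin
    det K N
      ≈⟨ det-blockTriangular p N (λ x q → trans
           (reflexive (≡.cong (λ q → N (x ↑ˡ k ℕ.* p) (p ↑ʳ q)) (≡.sym (combine-remQuot {k} p q))))
           (blocks zero x (suc (quotient {k} p q)) (proj₂ (remQuot {k} p q)))) ⟩
    det K (λ x y → N (x ↑ˡ k ℕ.* p) (y ↑ˡ k ℕ.* p)) * det K (λ q r → N (p ↑ʳ q) (p ↑ʳ r))
      ≈⟨ *-cong (det-cong {p} λ x y → blocks zero x zero y)
           (det-blockDiagonal k M (λ q r → N (p ↑ʳ q) (p ↑ʳ r))
             (λ i x j y → blocks (suc i) x (suc j) y)) ⟩
    det K M * det K M ^ k ∎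

  -- Characteristic matrices of graphs

  ⟦_⟧ : Bool → Carrier
  ⟦ b ⟧ = if b then 1# else 0#

  charMatrix : ∀ {n} → Graph n → Carrier → Mat n
  charMatrix G x a b = x * identity K a b - adjacencyMatrix K G a b

  charEntry-diagonal : ∀ x → x * 1# - 0# ≈ x
  charEntry-diagonal x = trans (+-cong (*-identityʳ x) -0#≈0#) (+-identityʳ x)

  charEntry-offDiagonal : ∀ x y → x * 0# - y ≈ - y
  charEntry-offDiagonal x y = trans (+-congʳ (zeroʳ x)) (+-identityˡ (- y))

  sum-⟦⟧ : ∀ {n} (f : Fin n → Bool) → sum (λ i → ⟦ f i ⟧) ≈ ∣ tabulate f ∣ · 1#
  sum-⟦⟧ {zero}  f = refl
  sum-⟦⟧ {suc n} f with f zero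
  ... | true  = +-congˡ (sum-⟦⟧ (f ∘ suc))
  ... | false = trans (+-identityˡ _) (sum-⟦⟧ (f ∘ suc))

  -- Adding up rows produces column sums; the symmetry of `adj` turns those of the adjacency matrix
  -- into degrees.
  charMatrix-columnSum : ∀ {p r} {G : Graph p} → Regular r G → ∀ x b →
    sum (λ a → charMatrix G x a b) ≈ x - r · 1#
  charMatrix-columnSum {p} {r} {G} regular x b = begin
    sum (λ a → x * identity K a b - ⟦ adj G a b ⟧)
      ≈⟨ ∑-distrib-+ (λ a → x * identity K a b) (λ a → - ⟦ adj G a b ⟧) ⟩
    sum (λ a → x * identity K a b) + sum (λ a → - ⟦ adj G a b ⟧)
      ≈⟨ +-cong
           (trans (sym (*-distribˡ-sum x (λ a → identity K a b))) (*-congˡ (sum-same b (λ _ → 1#))))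
           (sum-neg (λ a → ⟦ adj G a b ⟧)) ⟩
    x * 1# - sum (λ a → ⟦ adj G a b ⟧)
      ≈⟨ +-cong (*-identityʳ x) (-‿cong (begin
           sum (λ a → ⟦ adj G a b ⟧)  ≈⟨ sum-cong (λ a → reflexive (≡.cong ⟦_⟧ (symm G a b))) ⟩
           sum (λ a → ⟦ adj G b a ⟧)  ≈⟨ sum-⟦⟧ (adj G b) ⟩
           degree G b · 1#            ≈⟨ reflexive (≡.cong (_· 1#) (regular b)) ⟩
           r · 1#                     ∎)) ⟩
    x - r · 1# ∎

  -- A dominating vertex over a regular graph.

  module _ {p r : ℕ} (H : Graph (suc p)) (w : Fin (suc p))
           (dominating : ∀ y → adj H w (punchIn w y) ≡ true)
           (regular : Regular r (delete H w))
           {x t : Carrier} (t[x-r]≈1 : t * (x - r · 1#) ≈ 1#) where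

    private
      H∖w = delete H w

      dominating′ : ∀ y → adj H (punchIn w y) w ≡ true
      dominating′ y = ≡.trans (symm H (punchIn w y) w) (dominating y)

    -- Since `t` is the inverse of x - r, the first factor is x - p / (x - r): it depends on `H`
    -- only through its order and the degree `r`.
    charPoly-dominating : charPoly K (adjacencyMatrix K H) x ≈
      (x + sum {p} (λ _ → t * - 1#)) * charPoly K (adjacencyMatrix K H∖w) x
    charPoly-dominating = begin
      det K A
        ≈⟨ det-moveRow A w ⟩
      ε w * det K (A w ◂ B)
        ≈⟨ *-congˡ (det-addRows₀ (A w) B (λ _ → t) (λ y → y)) ⟨
      ε w * det K (row ◂ B)
        -- Only column `w` survives in the new top row. Its sign equals the one from moving the row,
        -- and `ε*ε≈1` removes both.
        ≈⟨ *-congˡ (sum-single w (λ j → ε j * row j * det K (minor (row ◂ B) j)) (λ y →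
             trans (*-congʳ (trans (*-congˡ (row-others y)) (zeroʳ _))) (zeroˡ _))) ⟩
      ε w * (ε w * row w * det K (minor (row ◂ B) w))
        ≈⟨ solve 3 (λ e r d → e :* ((e :* r) :* d) := (e :* e) :* (r :* d))
             refl (ε w) (row w) (det K (minor (row ◂ B) w)) ⟩
      ε w * ε w * (row w * det K (minor (row ◂ B) w))
        ≈⟨ *-cong (ε*ε≈1 w) (*-cong row-w (det-cong {p} λ a b → +-congʳ (*-congˡ
             (reflexive (≡.cong ⟦_⟧ (same-punchIn w a b)))))) ⟩
      1# * ((x + sum {p} (λ _ → t * - 1#)) * det K (charMatrix H∖w x))
        ≈⟨ *-identityˡ _ ⟩
      (x + sum {p} (λ _ → t * - 1#)) * det K (charMatrix H∖w x) ∎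
      where
      A : Mat (suc p)
      A = charMatrix H x
      B : Vector (Row (suc p)) p
      B = A ∘ punchIn w
      row : Row (suc p)
      row j = A w j + sum (λ y → t * B y j)

      row-w : row w ≈ x + sum {p} (λ _ → t * - 1#)
      row-w = +-cong
        (trans (reflexive (≡.cong₂ (λ b b′ → x * ⟦ b ⟧ - ⟦ b′ ⟧) (dec-true (w ≟ w) ≡.refl) (irrefl H w)))
          (charEntry-diagonal x))
        (sum-cong λ y → *-congˡ (trans
          (reflexive (≡.cong₂ (λ b b′ → x * ⟦ b ⟧ - ⟦ b′ ⟧)
            (dec-false (punchIn w y ≟ w) (punchInᵢ≢i w y)) (dominating′ y)))
          (charEntry-offDiagonal x 1#)))

      row-others : ∀ y → row (punchIn w y) ≈ 0#
      row-others y = begin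
        A w (punchIn w y) + sum (λ z → t * A (punchIn w z) (punchIn w y))
          ≈⟨ +-cong
               (trans (reflexive (≡.cong₂ (λ b b′ → x * ⟦ b ⟧ - ⟦ b′ ⟧)
                   (dec-false (w ≟ punchIn w y) (punchInᵢ≢i w y ∘ ≡.sym)) (dominating y)))
                 (charEntry-offDiagonal x 1#))
               (sum-cong λ z → *-congˡ {t} (+-congʳ (*-congˡ
                 (reflexive (≡.cong ⟦_⟧ (same-punchIn w z y)))))) ⟩
        - 1# + sum (λ z → t * charMatrix H∖w x z y)
          ≈⟨ +-congˡ (*-distribˡ-sum t (λ z → charMatrix H∖w x z y)) ⟨
        - 1# + t * sum (λ z → charMatrix H∖w x z y)
          ≈⟨ +-congˡ (*-congˡ (charMatrix-columnSum {G = H∖w} regular x y)) ⟩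
        - 1# + t * (x - r · 1#)
          ≈⟨ +-congˡ t[x-r]≈1 ⟩
        - 1# + 1#
          ≈⟨ -‿inverseˡ 1# ⟩
        0# ∎

  -- The characteristic polynomial of a graph with pockets.

  module _ {n k p : ℕ} (F : Graph n) (vs : Fin k → Fin n) (x t : Carrier) where

    -- The multipliers for `det-schur`: the row of `a` receives `t` times every row of a pocket
    -- attached at `a`.
    pocketWeight : Fin n → Fin (k ℕ.* p) → Carrier
    pocketWeight a z = t * ⟦ same a (vs (quotient {k} p z)) ⟧

    -- The Schur complement of the k diagonal blocks of the pockets.
    pocketCore : Mat n
    pocketCore a b = charMatrix F x a b +
      sum (λ z → pocketWeight a z * - ⟦ same (vs (quotient {k} p z)) b ⟧)

    -- Domination alone fixes the blocks between `F` and the pockets, so `pocketCore` does not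
    -- involve `H`, which enters only through the `k` equal diagonal blocks.
    charPoly-pockets : ∀ {r} (H : Graph (suc p)) (w : Fin (suc p)) →
      (∀ y → adj H w (punchIn w y) ≡ true) → Regular r (delete H w) →
      t * (x - r · 1#) ≈ 1# →
      charPoly K (adjacencyMatrix K (pockets F vs H w)) x ≈
        det K pocketCore * charPoly K (adjacencyMatrix K (delete H w)) x ^ k
    charPoly-pockets {r} H w dominating regular t[x-r]≈1 = begin
      det K A
        -- Each pocket index is rewritten as some `combine i y`, the form in which adjacency in
        -- `pockets` can be evaluated.
        ≈⟨ det-schur n A pocketWeight (λ a y → ≡.subst
             (λ y → A (a ↑ˡ q) (n ↑ʳ y) + sum (λ z → pocketWeight a z * A (n ↑ʳ z) (n ↑ʳ y)) ≈ 0#)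
             (combine-remQuot {k} p y)
             (upperRight a (quotient {k} p y) (proj₂ (remQuot {k} p y)))) ⟩
      det K (λ a b → A (a ↑ˡ q) (b ↑ˡ q) + sum (λ z → pocketWeight a z * A (n ↑ʳ z) (b ↑ˡ q))) *
      det K (λ y z → A (n ↑ʳ y) (n ↑ʳ z))
        ≈⟨ *-cong
             (det-cong {n} λ a b → +-cong (upperLeft a b) (sum-cong λ z → *-congˡ (lowerLeft z b)))
             (det-blockDiagonal k M (λ y z → A (n ↑ʳ y) (n ↑ʳ z)) lowerRight) ⟩
      det K pocketCore * det K M ^ k ∎
      where
      q = k ℕ.* p
      A : Mat (n ℕ.+ q)
      A = charMatrix (pockets F vs H w) x
      M : Mat p
      M = charMatrix (delete H w) x

      adjP = pocketAdj F vs H w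

      pv-F : ∀ a → pocketVertex F vs H w (a ↑ˡ q) ≡ inj₁ a
      pv-F a rewrite splitAt-↑ˡ n a q = ≡.refl

      pv-copy : ∀ z → pocketVertex F vs H w (n ↑ʳ z) ≡ inj₂ (remQuot p z)
      pv-copy z rewrite splitAt-↑ʳ n q z = ≡.refl

      pv-combine : ∀ i y → pocketVertex F vs H w (n ↑ʳ combine {k} i y) ≡ inj₂ (i , y)
      pv-combine i y = ≡.trans (pv-copy (combine {k} i y)) (≡.cong inj₂ (remQuot-combine i y))

      entry : ∀ {b b′ c c′} → b ≡ b′ → c ≡ c′ → x * ⟦ b ⟧ - ⟦ c ⟧ ≈ x * ⟦ b′ ⟧ - ⟦ c′ ⟧
      entry ≡.refl ≡.refl = refl

      upperLeft : ∀ a b → A (a ↑ˡ q) (b ↑ˡ q) ≈ charMatrix F x a b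
      upperLeft a b = entry (same-↑ˡ-↑ˡ q a b) (≡.cong₂ adjP (pv-F a) (pv-F b))

      lowerLeft : ∀ z b → A (n ↑ʳ z) (b ↑ˡ q) ≈ - ⟦ same (vs (quotient {k} p z)) b ⟧
      lowerLeft z b = trans
        (entry (same-↑ʳ-↑ˡ z b) (≡.trans (≡.cong₂ adjP (pv-copy z) (pv-F b))
          (≡.trans (≡.cong (same (vs (quotient {k} p z)) b ∧_)
            (≡.trans (symm H (punchIn w (proj₂ (remQuot {k} p z))) w)
                     (dominating (proj₂ (remQuot {k} p z)))))
            (∧-identityʳ _))))
        (charEntry-offDiagonal x _)

      A₁₂ : ∀ a j y → A (a ↑ˡ q) (n ↑ʳ combine {k} j y) ≈ - ⟦ same a (vs j) ⟧
      A₁₂ a j y = trans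
        (entry (same-↑ˡ-↑ʳ a (combine {k} j y)) (≡.trans (≡.cong₂ adjP (pv-F a) (pv-combine j y))
          (≡.trans (≡.cong (same a (vs j) ∧_) (dominating y)) (∧-identityʳ _))))
        (charEntry-offDiagonal x _)

      lowerRight : ∀ i y j z → A (n ↑ʳ combine {k} i y) (n ↑ʳ combine {k} j z) ≈
        (if same i j then M y z else 0#)
      lowerRight i y j z = trans
        (entry (≡.trans (same-↑ʳ-↑ʳ n (combine {k} i y) (combine {k} j z)) (same-combine i y j z))
               (≡.cong₂ adjP (pv-combine i y) (pv-combine j z)))
        (block (same i j))
        where
        block : ∀ s → x * ⟦ s ∧ same y z ⟧ - ⟦ s ∧ adj (delete H w) y z ⟧ ≈ (if s then M y z else 0#)
        block true  = refl
        block false = trans (charEntry-offDiagonal x 0#) -0#≈0#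

      upperRight : ∀ a j y → A (a ↑ˡ q) (n ↑ʳ combine {k} j y) +
        sum (λ z → pocketWeight a z * A (n ↑ʳ z) (n ↑ʳ combine {k} j y)) ≈ 0#
      upperRight a j y = begin
        A (a ↑ˡ q) (n ↑ʳ combine {k} j y) +
        sum (λ z → pocketWeight a z * A (n ↑ʳ z) (n ↑ʳ combine {k} j y))
          ≈⟨ +-cong (A₁₂ a j y) (sum-combine k {p}
               (λ z → pocketWeight a z * A (n ↑ʳ z) (n ↑ʳ combine {k} j y))) ⟩
        - ⟦ same a (vs j) ⟧ + sum (λ i → sum (λ z →
          pocketWeight a (combine {k} i z) * A (n ↑ʳ combine {k} i z) (n ↑ʳ combine {k} j y)))
          -- Only the rows of copy `j` meet this column; there the column sum x - r cancels against
          -- `t`.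
          ≈⟨ +-congˡ (sum-cong λ i → trans
               (sum-cong λ z → *-cong
                 (reflexive (≡.cong (λ i → t * ⟦ same a (vs i) ⟧) (≡.cong proj₁ (remQuot-combine i z))))
                 (lowerRight i z j y))
               (copy i (same i j))) ⟩
        - ⟦ same a (vs j) ⟧ + sum (λ i → if same i j then ⟦ same a (vs i) ⟧ else 0#)
          ≈⟨ +-congˡ (sum-same j (λ i → ⟦ same a (vs i) ⟧)) ⟩
        - ⟦ same a (vs j) ⟧ + ⟦ same a (vs j) ⟧
          ≈⟨ -‿inverseˡ _ ⟩
        0# ∎
        where
        copy : ∀ i s → sum (λ z → t * ⟦ same a (vs i) ⟧ * (if s then M z y else 0#)) ≈
                       (if s then ⟦ same a (vs i) ⟧ else 0#)
        copy i false = sum-zero {p} (λ z → zeroʳ _)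
        copy i true  = begin
          sum (λ z → t * ⟦ same a (vs i) ⟧ * M z y)  ≈⟨ *-distribˡ-sum _ (λ z → M z y) ⟨
          t * ⟦ same a (vs i) ⟧ * sum (λ z → M z y)
            ≈⟨ *-congˡ (charMatrix-columnSum {G = delete H w} regular x y) ⟩
          t * ⟦ same a (vs i) ⟧ * (x - r · 1#)
            ≈⟨ solve 3 (λ t b s → (t :* b) :* s := (t :* s) :* b) refl t _ _ ⟩
          t * (x - r · 1#) * ⟦ same a (vs i) ⟧       ≈⟨ *-congʳ t[x-r]≈1 ⟩
          1# * ⟦ same a (vs i) ⟧                     ≈⟨ *-identityˡ _ ⟩
          ⟦ same a (vs i) ⟧ ∎

  -- Polynomial functions

  -- Polynomial ℓ d f : f is given by a polynomial of degree at most d in which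
  -- x ^ d has coefficient ℓ.
  data Polynomial (ℓ : Carrier) : ℕ → (Carrier → Carrier) → Set (c ⊔ ℓ₁) where
    constant : ∀ {f} → (∀ x → f x ≈ ℓ) → Polynomial ℓ zero f
    horner   : ∀ {d f g} a → Polynomial ℓ d g → (∀ x → f x ≈ a + x * g x) → Polynomial ℓ (suc d) f

  polynomial-cong : ∀ {ℓ ℓ′ d f g} → ℓ ≈ ℓ′ → (∀ x → f x ≈ g x) →
    Polynomial ℓ d f → Polynomial ℓ′ d g
  polynomial-cong ℓ≈ℓ′ f≈g (constant e)   = constant λ x → trans (sym (f≈g x)) (trans (e x) ℓ≈ℓ′)
  polynomial-cong ℓ≈ℓ′ f≈g (horner a P e) =
    horner a (polynomial-cong ℓ≈ℓ′ (λ _ → refl) P) λ x → trans (sym (f≈g x)) (e x)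

  polynomial-+ : ∀ {ℓ ℓ′ d f g} → Polynomial ℓ d f → Polynomial ℓ′ d g →
    Polynomial (ℓ + ℓ′) d (λ x → f x + g x)
  polynomial-+ (constant e)   (constant e′)    = constant λ x → +-cong (e x) (e′ x)
  polynomial-+ (horner a P e) (horner a′ P′ e′) = horner (a + a′) (polynomial-+ P P′) λ x →
    trans (+-cong (e x) (e′ x))
      (solve 5 (λ a a′ x g g′ → (a :+ x :* g) :+ (a′ :+ x :* g′) := (a :+ a′) :+ x :* (g :+ g′))
        refl a a′ x _ _)

  polynomial-scale : ∀ {ℓ d f} b → Polynomial ℓ d f → Polynomial (b * ℓ) d (λ x → b * f x)
  polynomial-scale b (constant e)   = constant λ x → *-congˡ (e x)
  polynomial-scale b (horner a P e) = horner (b * a) (polynomial-scale b P) λ x →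
    trans (*-congˡ (e x))
      (solve 4 (λ b a x g → b :* (a :+ x :* g) := b :* a :+ x :* (b :* g)) refl b a x _)

  -- The leading coefficient 0 allows summands of different degrees to be brought to a common bound
  -- for `polynomial-+`.
  polynomial-weaken : ∀ {ℓ d f} → Polynomial ℓ d f → Polynomial 0# (suc d) f
  polynomial-weaken {ℓ} (constant e) = horner ℓ (constant {f = λ _ → 0#} λ _ → refl) λ x →
    trans (e x) (sym (trans (+-congˡ (zeroʳ x)) (+-identityʳ ℓ)))
  polynomial-weaken (horner a P e) = horner a (polynomial-weaken P) e

  -- Entries of a matrix x A + B are linear in x, so this is the only kind of product that Laplace
  -- expansion calls for.
  polynomial-linear : ∀ {ℓ d f} α β → Polynomial ℓ d f →
    Polynomial (α * ℓ) (suc d) (λ x → (x * α + β) * f x)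
  polynomial-linear {f = f} α β P = polynomial-cong (+-identityʳ _)
    (λ x → solve 4 (λ x a b f → (con 0 :+ x :* (a :* f)) :+ b :* f := (x :* a :+ b) :* f)
      refl x α β (f x))
    (polynomial-+
      (horner {f = λ x → 0# + x * (α * f x)} 0# (polynomial-scale α P) (λ _ → refl))
      (polynomial-weaken (polynomial-scale β P)))

  polynomial-zero : ∀ d → Polynomial 0# d (λ _ → 0#)
  polynomial-zero zero    = constant λ _ → refl
  polynomial-zero (suc d) = polynomial-weaken (polynomial-zero d)

  polynomial-sum : ∀ {n d} {ℓ : Fin n → Carrier} {f : Fin n → Carrier → Carrier} →
    (∀ j → Polynomial (ℓ j) d (f j)) → Polynomial (sum ℓ) d (λ x → sum (λ j → f j x))
  polynomial-sum {zero}  {d} P = polynomial-zero d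
  polynomial-sum {suc n}     P = polynomial-+ (P zero) (polynomial-sum (P ∘ suc))

  polynomial-term : ∀ {ℓ d f} e α β → Polynomial ℓ d f →
    Polynomial (e * (α * ℓ)) (suc d) (λ x → e * (x * α + β) * f x)
  polynomial-term e α β P =
    polynomial-cong refl (λ x → sym (*-assoc _ _ _)) (polynomial-scale e (polynomial-linear α β P))

  -- The leading coefficient is left unspecified: `charPoly-polynomial` multiplies it by 0 and uses
  -- only the degree bound.
  det-polynomial : ∀ {n} (A B : Mat n) →
    ∃[ ℓ ] Polynomial ℓ n (λ x → det K (λ a b → x * A a b + B a b))
  det-polynomial {zero}  A B = 1# , constant λ _ → refl
  det-polynomial {suc n} A B = _ , polynomial-sum λ j →
    polynomial-term (ε j) (A zero j) (B zero j) (proj₂ (det-polynomial (minor A j) (minor B j)))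

  -- In row 0 only the diagonal entry contains x, and its minor is a characteristic matrix one size
  -- down. The other terms have a constant entry and so add nothing to the top coefficient.
  charPoly-polynomial : ∀ {n} (A : Mat n) → Polynomial 1# n (charPoly K A)
  charPoly-polynomial {zero}  A = constant λ _ → refl
  charPoly-polynomial {suc n} A = polynomial-cong
    (trans (+-congˡ (sum-replicate-zero n)) (+-identityʳ 1#)) (λ _ → refl)
    (polynomial-sum {ℓ = 1# ◂ λ _ → 0#} term)
    where
    I = identity K {suc n}
    term : ∀ j → Polynomial ((1# ◂ λ _ → 0#) j) (suc n)
      (λ x → ε j * (x * I zero j - A zero j) * det K (λ a b → x * minor I j a b - minor A j a b))
    term zero = polynomial-cong (trans (*-identityˡ _) (*-identityˡ 1#)) (λ _ → refl)
      (polynomial-term 1# 1# (- A zero zero) (charPoly-polynomial (minor A zero)))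
    term (suc j) = polynomial-cong (trans (*-congˡ (zeroˡ _)) (zeroʳ _)) (λ _ → refl)
      (polynomial-term (ε (suc j)) 0# (- A zero (suc j))
        (proj₂ (det-polynomial (minor I (suc j)) (λ a b → - minor A (suc j) a b))))

  -- Division by linear factors and splitting.

  z+[x-z]≈x : ∀ x z → z + (x - z) ≈ x
  z+[x-z]≈x x z = trans (sym (+-assoc z x (- z))) (xyx⁻¹≈y z x)

  -- Synthetic division. If f = a + x g and g = g(z) + (x - z) h, then writing x as z + (x - z)
  -- gives the quotient g + z h, whose leading coefficient is that of g.
  factor : ∀ {ℓ d f} → Polynomial ℓ (suc d) f → ∀ z →
    ∃[ q ] Polynomial ℓ d q × (∀ x → f x ≈ f z + (x - z) * q x)
  factor {ℓ} {zero} {f} (horner {g = g} a (constant g≈ℓ) e) z =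
    (λ _ → ℓ) , constant (λ _ → refl) , λ x → begin
      f x                          ≈⟨ e x ⟩
      a + x * g x                  ≈⟨ +-congˡ (*-cong (sym (z+[x-z]≈x x z)) (g≈ℓ x)) ⟩
      a + (z + (x - z)) * ℓ        ≈⟨ solve 4 (λ a z t l → a :+ (z :+ t) :* l := (a :+ z :* l) :+ t :* l)
                                        refl a z (x - z) ℓ ⟩
      a + z * ℓ + (x - z) * ℓ      ≈⟨ +-congʳ (trans (e z) (+-congˡ (*-congˡ (g≈ℓ z)))) ⟨
      f z + (x - z) * ℓ            ∎
  factor {ℓ} {suc d} {f} (horner {g = g} a P e) z with factor P z
  ... | h , Q , g≈ =
    (λ x → g x + z * h x) ,
    polynomial-cong (+-identityʳ ℓ) (λ _ → refl)
      (polynomial-+ P (polynomial-cong refl (λ _ → refl) (polynomial-weaken (polynomial-scale z Q)))) ,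
    λ x → begin
      f x
        ≈⟨ e x ⟩
      a + x * g x
        ≈⟨ +-congˡ (*-cong (sym (z+[x-z]≈x x z)) (g≈ x)) ⟩
      a + (z + (x - z)) * (g z + (x - z) * h x)
        ≈⟨ solve 5 (λ a z t g h → a :+ (z :+ t) :* (g :+ t :* h) :=
             (a :+ z :* g) :+ t :* ((g :+ t :* h) :+ z :* h)) refl a z (x - z) (g z) (h x) ⟩
      a + z * g z + (x - z) * (g z + (x - z) * h x + z * h x)
        ≈⟨ +-cong (e z) (*-congˡ (+-congʳ (g≈ x))) ⟨
      f z + (x - z) * (g x + z * h x) ∎

  -- Passes from Horner form to the sum of powers in which `AlgebraicallyClosed` presents a
  -- polynomial.
  coefficients : ∀ {ℓ d f} → Polynomial ℓ d f →
    ∃[ a ] ∀ z → f z ≈ ℓ * z ^ d + sum {d} (λ i → a i * z ^ toℕ i)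
  coefficients {ℓ} (constant e) = (λ ()) , λ z →
    trans (e z) (sym (trans (+-identityʳ _) (*-identityʳ ℓ)))
  coefficients {ℓ} {suc d} {f} (horner {g = g} a₀ P e) with coefficients P
  ... | a , g≈ = (a₀ ◂ a) , λ z → begin
    f z
      ≈⟨ trans (e z) (+-congˡ (*-congˡ (g≈ z))) ⟩
    a₀ + z * (ℓ * z ^ d + sum (λ i → a i * z ^ toℕ i))
      ≈⟨ solve 5 (λ a z l p s → a :+ z :* (l :* p :+ s) := l :* (z :* p) :+ (a :* con 1 :+ z :* s))
           refl a₀ z ℓ (z ^ d) _ ⟩
    ℓ * (z * z ^ d) + (a₀ * 1# + z * sum (λ i → a i * z ^ toℕ i))
      ≈⟨ +-congˡ (+-congˡ (trans
           (*-distribˡ-sum z (λ i → a i * z ^ toℕ i))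
           (sum-cong λ i → solve 3 (λ z a p → z :* (a :* p) := a :* (z :* p)) refl z (a i) (z ^ toℕ i)))) ⟩
    ℓ * (z * z ^ d) + (a₀ * 1# + sum (λ i → a i * (z * z ^ toℕ i))) ∎

  -- At a root the remainder in `factor` is zero and the quotient is again monic, of degree one
  -- less.
  polynomial-splits : AlgebraicallyClosed K → ∀ {d f} → Polynomial 1# d f →
    ∃[ Λ ] ∀ x → f x ≈ foldr _*_ 1# (map (λ z → x - z) Λ)
  polynomial-splits closed (constant e) = [] , e
  polynomial-splits closed {suc d} {f} P with coefficients P
  ... | a , f≈ with closed d a
  ... | z , root with factor P z
  ... | q , Q , f≈q with polynomial-splits closed Q
  ... | Λ , q≈ = z ∷ Λ , λ x → begin
    f x                  ≈⟨ f≈q x ⟩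
    f z + (x - z) * q x  ≈⟨ +-cong (trans (f≈ z) (trans (+-congʳ (*-identityˡ _)) root)) (*-congˡ (q≈ x)) ⟩
    0# + (x - z) * foldr _*_ 1# (map (λ z → x - z) Λ)
                         ≈⟨ +-identityˡ _ ⟩
    (x - z) * foldr _*_ 1# (map (λ z → x - z) Λ) ∎

  -- Evaluation at natural numbers in characteristic zero.

  module _ (char0 : CharacteristicZero K) where

    nat-invertible : ∀ d → ∃[ v ] v * (suc d · 1#) ≈ 1#
    nat-invertible d with HeytingField.#⇒invertible K (char0 d)
    ... | v , left , _ = v , trans (*-congˡ (sym (trans (+-congˡ -0#≈0#) (+-identityʳ _)))) left

    -- Induction on the degree bound. The root k gives f = (x - k) q, and at k + 1 + i the factor x
    -- - k is the invertible 1 + i, so q vanishes at every natural number from k + 1 on. A constant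
    -- is settled by one value.
    polynomial-vanishes : ∀ {ℓ d f} → Polynomial ℓ d f →
      ∀ k → (∀ i → f ((k ℕ.+ i) · 1#) ≈ 0#) → ∀ x → f x ≈ 0#
    polynomial-vanishes (constant e) k roots x = trans (e x) (trans (sym (e _)) (roots 0))
    polynomial-vanishes {f = f} P@(horner _ _ _) k roots x with factor P (k · 1#)
    ... | q , Q , f≈ = begin
      f x                          ≈⟨ f≈ x ⟩
      f (k · 1#) + (x - k · 1#) * q x
        ≈⟨ +-cong fk≈0 (*-congˡ (polynomial-vanishes Q (suc k) q-roots x)) ⟩
      0# + (x - k · 1#) * 0#       ≈⟨ trans (+-identityˡ _) (zeroʳ _) ⟩
      0#                           ∎
      where
      fk≈0 : f (k · 1#) ≈ 0#
      fk≈0 = ≡.subst (λ j → f (j · 1#) ≈ 0#) (+-identityʳ-ℕ k) (roots 0)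

      q-roots : ∀ i → q ((suc k ℕ.+ i) · 1#) ≈ 0#
      q-roots i with nat-invertible i
      ... | v , v*[1+i]≈1 = begin
        q y                              ≈⟨ *-identityˡ _ ⟨
        1# * q y                         ≈⟨ *-congʳ v*[1+i]≈1 ⟨
        v * (suc i · 1#) * q y           ≈⟨ *-assoc _ _ _ ⟩
        v * ((suc i · 1#) * q y)         ≈⟨ *-congˡ (*-congʳ difference) ⟨
        v * ((y - k · 1#) * q y)         ≈⟨ *-congˡ (trans (+-congʳ fk≈0) (+-identityˡ _)) ⟨
        v * (f (k · 1#) + (y - k · 1#) * q y) ≈⟨ *-congˡ (f≈ y) ⟨
        v * f y                          ≈⟨ *-congˡ (≡.subst (λ j → f (j · 1#) ≈ 0#)
                                              (+-suc k i) (roots (suc i))) ⟩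
        v * 0#                           ≈⟨ zeroʳ v ⟩
        0#                               ∎
        where
        y = (suc k ℕ.+ i) · 1#
        difference : y - k · 1# ≈ suc i · 1#
        difference = begin
          y - k · 1#                        ≈⟨ +-congʳ (reflexive (≡.cong (_· 1#) (+-suc k i))) ⟨
          (k ℕ.+ suc i) · 1# - k · 1#       ≈⟨ +-congʳ (×-homo-+ 1# k (suc i)) ⟩
          k · 1# + suc i · 1# - k · 1#      ≈⟨ xyx⁻¹≈y _ _ ⟩
          suc i · 1#                        ∎

    module _ {p r i : ℕ} where

      private
        -- `x` is a sample point and `s` is x - r. Starting above r + p makes both s and x s - p
        -- positive.
        s x : ℕ
        s = suc (p ℕ.+ i)
        x = r ℕ.+ s

      x-r≈s : x · 1# - r · 1# ≈ s · 1#
      x-r≈s = trans (+-congʳ (×-homo-+ 1# r s)) (xyx⁻¹≈y _ _)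

      -- x s - p is positive; p is moved to the other side so that no subtraction occurs.
      x*s≡p+1+d : x ℕ.* s ≡ p ℕ.+ suc (i ℕ.+ ((p ℕ.+ i) ℕ.* s ℕ.+ r ℕ.* s))
      x*s≡p+1+d = +-*-Solver.solve 3 (λ p r i →
        (r ⊕ (κ 1 ⊕ (p ⊕ i))) ⊗ (κ 1 ⊕ (p ⊕ i)) ⊜
        p ⊕ (κ 1 ⊕ (i ⊕ ((p ⊕ i) ⊗ (κ 1 ⊕ (p ⊕ i)) ⊕ r ⊗ (κ 1 ⊕ (p ⊕ i)))))) ≡.refl p r i
        where
        open +-*-Solver renaming (_:+_ to _⊕_; _:*_ to _⊗_; _:=_ to _⊜_; con to κ)

      -- Multiplication by s turns x - p / s into x s - p, which is the positive number 1 + d. The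
      -- inverse is therefore s / (1 + d).
      dominatingFactor-invertible : ∀ {t} → t * (x · 1# - r · 1#) ≈ 1# →
        ∃[ v ] v * (x · 1# + sum {p} (λ _ → t * - 1#)) ≈ 1#
      dominatingFactor-invertible {t} t[x-r]≈1
        with nat-invertible (i ℕ.+ ((p ℕ.+ i) ℕ.* s ℕ.+ r ℕ.* s))
      ... | v , v*[1+d]≈1 = v * s · 1# , (begin
        v * s · 1# * e    ≈⟨ solve 3 (λ v s e → (v :* s) :* e := v :* (e :* s)) refl v (s · 1#) e ⟩
        v * (e * s · 1#)  ≈⟨ *-congˡ e*s≈1+d ⟩
        v * suc d · 1#    ≈⟨ v*[1+d]≈1 ⟩
        1#                ∎)
        where
        d = i ℕ.+ ((p ℕ.+ i) ℕ.* s ℕ.+ r ℕ.* s)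
        e = x · 1# + sum {p} (λ _ → t * - 1#)

        correction : sum {p} (λ _ → t * - 1#) * s · 1# ≈ - (p · 1#)
        correction = begin
          sum {p} (λ _ → t * - 1#) * s · 1#
            ≈⟨ *-distribʳ-sum (s · 1#) (λ (_ : Fin p) → t * - 1#) ⟩
          sum {p} (λ _ → t * - 1# * s · 1#)
            ≈⟨ sum-cong {p} (λ _ → begin
                 t * - 1# * s · 1#
                   ≈⟨ solve 3 (λ t m s → (t :* m) :* s := m :* (t :* s)) refl t (- 1#) (s · 1#) ⟩
                 - 1# * (t * s · 1#)   ≈⟨ -1*x≈-x _ ⟩
                 - (t * s · 1#)        ≈⟨ -‿cong (trans (*-congˡ (sym x-r≈s)) t[x-r]≈1) ⟩
                 - 1#                  ∎) ⟩
          sum {p} (λ _ → - 1#)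
            ≈⟨ sum-neg {p} (λ _ → 1#) ⟩
          - sum {p} (λ _ → 1#)
            ≈⟨ -‿cong (sum-replicate p) ⟩
          - (p · 1#) ∎

        e*s≈1+d : e * s · 1# ≈ suc d · 1#
        e*s≈1+d = begin
          e * s · 1#
            ≈⟨ distribʳ (s · 1#) _ _ ⟩
          x · 1# * s · 1# + sum {p} (λ _ → t * - 1#) * s · 1#
            ≈⟨ +-cong (sym (×1-homo-* x s)) correction ⟩
          (x ℕ.* s) · 1# - p · 1#
            ≈⟨ +-congʳ (trans (reflexive (≡.cong (_· 1#) x*s≡p+1+d)) (×-homo-+ 1# p (suc d))) ⟩
          p · 1# + suc d · 1# - p · 1#
            ≈⟨ xyx⁻¹≈y _ _ ⟩
          suc d · 1# ∎

    -- The difference of the two characteristic polynomials vanishes at all sample points, hence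
    -- everywhere.
    charPoly-pockets-cong : ∀ {n k p r} (F : Graph n) (vs : Fin k → Fin n)
      (Hu Hv : Graph (suc p)) (u v : Fin (suc p)) →
      (∀ y → adj Hu u (punchIn u y) ≡ true) → (∀ y → adj Hv v (punchIn v y) ≡ true) →
      Regular r (delete Hu u) → Regular r (delete Hv v) →
      (∀ x → charPoly K (adjacencyMatrix K Hu) x ≈ charPoly K (adjacencyMatrix K Hv) x) →
      ∀ x → charPoly K (adjacencyMatrix K (pockets F vs Hu u)) x ≈
            charPoly K (adjacencyMatrix K (pockets F vs Hv v)) x
    charPoly-pockets-cong {n} {k} {p} {r} F vs Hu Hv u v domU domV regU regV Hu≈Hv x =
      x∙y⁻¹≈ε⇒x≈y _ _ (polynomial-vanishes
        -- The top coefficient of the difference is 1 - 1; this is harmless, as `Polynomial` only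
        -- bounds the degree.
        (polynomial-cong refl (λ x → +-congˡ (-1*x≈-x (χ Gv x)))
          (polynomial-+ (charPoly-polynomial (adjacencyMatrix K Gu))
            (polynomial-scale (- 1#) (charPoly-polynomial (adjacencyMatrix K Gv)))))
        -- The first sample point; `agree` brackets the same points as r + (1 + (p + i)), hence the
        -- reassociation below.
        (r ℕ.+ suc p)
        (λ i → x≈y⇒x∙y⁻¹≈ε (≡.subst (λ j → χ Gu (j · 1#) ≈ χ Gv (j · 1#))
          (≡.sym (+-assoc-ℕ r (suc p) i)) (agree i)))
        x)
      where
      χ : ∀ {m} → Graph m → Carrier → Carrier
      χ G = charPoly K (adjacencyMatrix K G)
      Gu = pockets F vs Hu u
      Gv = pockets F vs Hv v

      agree : ∀ i → χ Gu ((r ℕ.+ suc (p ℕ.+ i)) · 1#) ≈ χ Gv ((r ℕ.+ suc (p ℕ.+ i)) · 1#)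
      agree i with nat-invertible (p ℕ.+ i)
      ... | t , t*s≈1
        with trans (*-congˡ {t} (x-r≈s {p} {r} {i})) t*s≈1
      ... | t[x-r]≈1 with dominatingFactor-invertible {p} {r} {i} t[x-r]≈1
      ... | z , z*e≈1 = begin
        χ Gu y
          ≈⟨ charPoly-pockets F vs y t Hu u domU regU t[x-r]≈1 ⟩
        det K (pocketCore {p = p} F vs y t) * χ (delete Hu u) y ^ k
          ≈⟨ *-congˡ (^-congˡ k deleted) ⟩
        det K (pocketCore {p = p} F vs y t) * χ (delete Hv v) y ^ k
          ≈⟨ charPoly-pockets F vs y t Hv v domV regV t[x-r]≈1 ⟨
        χ Gv y ∎
        where
        y = (r ℕ.+ suc (p ℕ.+ i)) · 1#
        e = y + sum {p} (λ _ → t * - 1#)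

        cancel : ∀ a → z * (e * a) ≈ a
        cancel a = trans (sym (*-assoc z e a)) (trans (*-congʳ z*e≈1) (*-identityˡ a))

        -- The factor `e` is common to both graphs and has the inverse `z`, so the equality for `Hu`
        -- and `Hv` passes to the graphs without `u` and `v`.
        deleted : χ (delete Hu u) y ≈ χ (delete Hv v) y
        deleted = begin
          χ (delete Hu u) y            ≈⟨ cancel _ ⟨
          z * (e * χ (delete Hu u) y)  ≈⟨ *-congˡ (charPoly-dominating Hu u domU regU t[x-r]≈1) ⟨
          z * χ Hu y                   ≈⟨ *-congˡ (Hu≈Hv y) ⟩
          z * χ Hv y                   ≈⟨ *-congˡ (charPoly-dominating Hv v domV regV t[x-r]≈1) ⟩
          z * (e * χ (delete Hv v) y)  ≈⟨ cancel _ ⟩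
          χ (delete Hv v) y            ∎

-- Dominating vertices from degrees.

∣tabulate∣-punchIn : ∀ {n} (f : Fin (suc n) → Bool) w → f w ≡ false →
  ∣ tabulate f ∣ ≡ ∣ tabulate (f ∘ punchIn w) ∣
∣tabulate∣-punchIn f zero fw≡false with f zero
∣tabulate∣-punchIn f zero ≡.refl | false = ≡.refl
∣tabulate∣-punchIn {suc n} f (suc w) fw≡false with f zero
... | true  = ≡.cong suc (∣tabulate∣-punchIn (f ∘ suc) w fw≡false)
... | false = ∣tabulate∣-punchIn (f ∘ suc) w fw≡false

-- By irreflexivity the `p` neighbours of `w` lie among the `p` other vertices, and so exhaust them.
degree-max⇒dominating : ∀ {p} (H : Graph (suc p)) w → degree H w ≡ p →
  ∀ y → adj H w (punchIn w y) ≡ true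
degree-max⇒dominating H w deg≡p y = begin
  adj H w (punchIn w y)     ≡⟨ lookup∘tabulate _ y ⟨
  lookup others-adjacent y  ≡⟨ ≡.cong (λ s → lookup s y) (∣p∣≡n⇒p≡⊤ {p = others-adjacent}
    (≡.trans (≡.sym (∣tabulate∣-punchIn (adj H w) w (irrefl H w))) deg≡p)) ⟩
  lookup ⊤ y                ≡⟨ lookup-replicate y true ⟩
  true                      ∎
  where
  open ≡.≡-Reasoning
  others-adjacent = tabulate (adj H w ∘ punchIn w)

corollary3p3 : {c ℓ₁ ℓ₂ : Level} (K : HeytingField c ℓ₁ ℓ₂) →
    CharacteristicZero K → AlgebraicallyClosed K →
    (n k m r₁ : ℕ) → 1 ≤ n → 2 ≤ m → 1 ≤ r₁ →
    (F : Graph n) (vs : Fin k → Fin n) → Injective _≡_ _≡_ vs →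
    (Hu Hv : Graph m) (u v : Fin m) →
    degree Hu u ≡ m ∸ 1 → degree Hv v ≡ m ∸ 1 →
    Regular r₁ (delete Hu u) → Regular r₁ (delete Hv v) →
    Cospectral K Hu Hv →
    Cospectral K (pockets F vs Hu u) (pockets F vs Hv v)
corollary3p3 K char0 closed n k (suc p) r₁ _ _ _ F vs _ Hu Hv u v degU degV regU regV (_ , specU , specV) =
  proj₁ splitting , proj₂ splitting ,
  -- The factorisation found for the pockets of `Hu` carries over to those of `Hv`, as the two
  -- characteristic polynomials agree at every point.
  λ x → trans (sym (charPoly-pockets-cong char0 F vs Hu Hv u v
    (degree-max⇒dominating Hu u degU) (degree-max⇒dominating Hv v degV) regU regV
    (λ x → trans (specU x) (sym (specV x))) x)) (proj₂ splitting x)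
  where
  open HeytingField K using (trans; sym)
  open LinearAlgebra K
  splitting = polynomial-splits closed
    (charPoly-polynomial (adjacencyMatrix K (pockets F vs Hu u)))
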